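{- Let $(\mathcal{P},\mathcal{B})$ be an $\mathrm{SRPG}(s,t;\alpha_1,\dots,\alpha_r;\lambda,\mu)$ with $n=|\mathcal{B}|$ blocks, such that $\alpha_i\ge2$ for some $1\le i\le r$, and let $M$ be its incidence matrix. Then the exact number of $6$-cycles in the Tanner graph of the LDPC code $C(M)$ is $$\frac{n\,s(s+1)(\lambda-s+1)}{6}.$$
   Context: A generalized partial geometry of grade $r$, denoted $\mathrm{PG}(s,t;\alpha_1,\dots,\alpha_r)$, is an incidence structure $(\mathcal{P},\mathcal{B})$, with $\mathcal{P}$ a finite non-empty set of points and $\mathcal{B}$ a family of subsets of $\mathcal{P}$ (blocks), incidence being containment, such that: (i) any two distinct points are incident with at most one common block; (ii) each block is incident with exactly $s+1$ points; (iii) each point is incident with exactly $t+1$ blocks; (iv) for any point $P$ and block $B$ with $P\notin B$, there is $\alpha\in\{\alpha_1,\dots,\alpha_r\}$ such that exactly $\alpha$ points of $B$ are joined to $P$ (two points are joined if some block contains both); (v) for each $\alpha\in\{\alpha_1,\dots,\alpha_r\}$ there exist a point $P$ and a block $B$ with $P\notin B$ such that exactly $\alpha$ points of $B$ are joined to $P$. The point graph of $(\mathcal{P},\mathcal{B})$ has vertex set $\mathcal{P}$, two distinct points being adjacent if and only if some block contains both. A $k$-regular graph on $v$ vertices is strongly regular with parameters $(v,k,\lambda,\mu)$ if any two adjacent vertices have exactly $\lambda$ common neighbours and any two distinct non-adjacent vertices have exactly $\mu$ common neighbours. A $\mathrm{PG}(s,t;\alpha_1,\dots,\alpha_r)$ whose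 point graph is strongly regular with parameters $(v,k,\lambda,\mu)$ is denoted $\mathrm{SRPG}(s,t;\alpha_1,\dots,\alpha_r;\lambda,\mu)$; its parameters are $k=s(t+1)$ and $v=\frac{k(k-\lambda-1)}{\mu}+k+1$. The incidence matrix $M$ is the $0/1$ matrix with rows indexed by points and columns by blocks, with entry $1$ exactly when the point lies on the block, and $C(M)$ is the binary linear code with parity-check matrix $M$. The Tanner graph of $C(M)$ is the bipartite graph with vertex set $\mathcal{P}\cup\mathcal{B}$ in which a point and a block are adjacent if and only if the point lies in the block. A $6$-cycle is a cycle subgraph of length $6$ (counted without orientation or starting point). -}

module Defs where

open import Data.Bool using (if_then_else_)
open import Data.Empty using (⊥)
open import Data.Fin using (Fin; toℕ; _≟_)
open import Data.Fin.Patterns using (0F; 1F)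
open import Data.Fin.Properties using (any?)
open import Data.Fin.Subset using (Subset; _∈_; _∉_; ∣_∣)
open import Data.Fin.Subset.Properties using (_∈?_)
open import Data.List using (length; filter; allFin)
open import Data.Nat using (ℕ; suc; _*_; NonZero)
open import Data.Nat.DivMod using (_mod_)
open import Data.Product using (_×_; _,_; ∃; ∃-syntax)
open import Data.Sum using (_⊎_; inj₁; inj₂)
open import Function using (_⇔_; mk⇔; Equivalence)
open import Function.Definitions using (Injective)
open import Level using (0ℓ)
open import Relation.Binary using (Setoid; Rel; Decidable; Symmetric)
open import Relation.Binary.PropositionalEquality using (_≡_; _≢_; refl; sym)
open import Relation.Nullary using (¬_; does; no)
open import Relation.Nullary.Decidable using (_×-dec_; ¬?)
import Relation.Unary as U

count : ∀ {n} {P : U.Pred (Fin n) 0ℓ} → U.Decidable P → ℕ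
count {n} P? = length (filter P? (allFin n))

record Graph (V : Set) : Set₁ where
  field
    _~_    : Rel V 0ℓ
    _~?_   : Decidable _~_
    ~-sym  : Symmetric _~_
    ~-irrefl : ∀ {x} → ¬ (x ~ x)

module _ {v : ℕ} (G : Graph (Fin v)) where
  open Graph G

  degree : Fin v → ℕ
  degree x = count (λ z → x ~? z)

  commonNeighbours : Fin v → Fin v → ℕ
  commonNeighbours x y = count (λ z → (x ~? z) ×-dec (y ~? z))

  record IsStronglyRegular (k lam μ : ℕ) : Set where
    field
      regular     : ∀ x → degree x ≡ k
      adjacent    : ∀ x y → x ~ y → commonNeighbours x y ≡ lam
      nonadjacent : ∀ x y → x ≢ y → ¬ (x ~ y) → commonNeighbours x y ≡ μ

-- The length-m cycle subgraphs of a graph (meaningful for m ≥ 3), given by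
-- cyclic enumerations of their vertices. Each subgraph has 2m enumerations,
-- which are identified in CycleSetoid because they have the same edges.
module _ {V : Set} (G : Graph V) (m : ℕ) .{{_ : NonZero m}} where
  open Graph G

  next : Fin m → Fin m
  next i = suc (toℕ i) mod m

  record Cycle : Set where
    field
      vertex    : Fin m → V
      injective : Injective _≡_ _≡_ vertex
      adjacent  : ∀ i → vertex i ~ vertex (next i)

  HasEdge : Cycle → Rel V 0ℓ
  HasEdge c x y = ∃[ i ] ((x ≡ vertex i × y ≡ vertex (next i)) ⊎ (y ≡ vertex i × x ≡ vertex (next i)))
    where open Cycle c

  CycleSetoid : Setoid 0ℓ 0ℓ
  CycleSetoid = record
    { Carrier = Cycle
    ; _≈_ = λ c d → ∀ x y → HasEdge c x y ⇔ HasEdge d x y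
    ; isEquivalence = record
      { refl  = λ x y → mk⇔ (λ e → e) (λ e → e)
      ; sym   = λ c≈d x y → mk⇔ (from (c≈d x y)) (to (c≈d x y))
      ; trans = λ c≈d d≈e x y → mk⇔ (λ e → to (d≈e x y) (to (c≈d x y) e))
                                     (λ e → from (c≈d x y) (from (d≈e x y) e))
      }
    }
    where open Equivalence

-- The set of blocks is enumerated without repetition, so that n = |B|.
record IncidenceStructure (v n : ℕ) : Set where
  field
    nonEmpty       : NonZero v
    block          : Fin n → Subset v
    blocksDistinct : Injective _≡_ _≡_ block

module _ {v n : ℕ} (I : IncidenceStructure v n) where
  open IncidenceStructure I

  Joined : Rel (Fin v) 0ℓ
  Joined p q = ∃[ b ] (p ∈ block b × q ∈ block b)

  joined? : Decidable Joined
  joined? p q = any? (λ b → (p ∈? block b) ×-dec (q ∈? block b))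

  joinedPoints : Fin v → Fin n → ℕ
  joinedPoints p b = count (λ q → (q ∈? block b) ×-dec joined? p q)

  record IsPG (s t : ℕ) {r : ℕ} (α : Fin r → ℕ) : Set where
    field
      atMostOneBlock : ∀ {p q} → p ≢ q → ∀ {b c} →
                       p ∈ block b → q ∈ block b → p ∈ block c → q ∈ block c → b ≡ c
      blockSize      : ∀ b → ∣ block b ∣ ≡ suc s
      pointDegree    : ∀ p → count (λ b → p ∈? block b) ≡ suc t
      joinedCount    : ∀ p b → p ∉ block b → ∃[ i ] joinedPoints p b ≡ α i
      attained       : ∀ i → ∃[ p ] ∃[ b ] (p ∉ block b × joinedPoints p b ≡ α i)

  pointGraph : Graph (Fin v)
  pointGraph = record
    { _~_      = λ p q → p ≢ q × Joined p q
    ; _~?_     = λ p q → ¬? (p ≟ q) ×-dec joined? p q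
    ; ~-sym    = λ { (p≢q , b , p∈b , q∈b) → (λ q≡p → p≢q (sym q≡p)) , b , q∈b , p∈b }
    ; ~-irrefl = λ { (p≢p , _) → p≢p refl }
    }

  record IsSRPG (s t : ℕ) {r : ℕ} (α : Fin r → ℕ) (lam μ : ℕ) : Set where
    field
      isPG              : IsPG s t α
      isStronglyRegular : IsStronglyRegular pointGraph (s * suc t) lam μ

BinaryMatrix : ℕ → ℕ → Set
BinaryMatrix m n = Fin m → Fin n → Fin 2

incidenceMatrix : ∀ {v n} → IncidenceStructure v n → BinaryMatrix v n
incidenceMatrix I p b = if does (p ∈? block b) then 1F else 0F
  where open IncidenceStructure I

-- A Tanner graph depends on the parity-check matrix presenting the code, not
-- only on the set of codewords, so it is a function of that matrix.
module _ {m n : ℕ} (H : BinaryMatrix m n) where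

  TannerAdj : Rel (Fin m ⊎ Fin n) 0ℓ
  TannerAdj (inj₁ i) (inj₂ j) = H i j ≡ 1F
  TannerAdj (inj₂ j) (inj₁ i) = H i j ≡ 1F
  TannerAdj (inj₁ _) (inj₁ _) = ⊥
  TannerAdj (inj₂ _) (inj₂ _) = ⊥

  tannerGraph : Graph (Fin m ⊎ Fin n)
  tannerGraph = record
    { _~_      = TannerAdj
    ; _~?_     = adj?
    ; ~-sym    = λ {x} {y} → symm x y
    ; ~-irrefl = λ {x} → irr x
    }
    where
    adj? : Decidable TannerAdj
    adj? (inj₁ i) (inj₂ j) = H i j ≟ 1F
    adj? (inj₂ j) (inj₁ i) = H i j ≟ 1F
    adj? (inj₁ _) (inj₁ _) = no λ ()
    adj? (inj₂ _) (inj₂ _) = no λ ()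

    symm : ∀ x y → TannerAdj x y → TannerAdj y x
    symm (inj₁ _) (inj₂ _) e = e
    symm (inj₂ _) (inj₁ _) e = e

    irr : ∀ x → ¬ TannerAdj x x
    irr (inj₁ _) ()
    irr (inj₂ _) ()

{-# OPTIONS --safe #-}

-- The points p, q, z of a 6-cycle p–b–q–d–z–e are pairwise joined but not on
-- one block, and conversely such a triangle determines its three blocks. So
-- 6-cycles correspond to noncollinear triangles, and each is represented by
-- its increasing enumeration p < q < z. Of the λ common neighbours of two
-- points joined by a block b, exactly s − 1 lie on b and the other λ − s + 1
-- complete the pair to a noncollinear triangle. There are vk = vs(t + 1) =
-- ns(s + 1) ordered joined pairs, and each triangle is counted 6 times.

module Submission where

open import Data.Bool using (if_then_else_)
open import Data.Empty using (⊥-elim)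
open import Data.Fin using (Fin; zero; suc; _≟_) renaming (_≤_ to _≤ᶠ_; _<_ to _<ᶠ_; _<?_ to _<ᶠ?_)
open import Data.Fin.Patterns using (0F; 1F; 2F; 3F; 4F; 5F)
open import Data.Fin.Properties as Fin using (all?; any?)
open import Data.Fin.Subset using (Subset; _∈_; ⁅_⁆; ∣_∣; inside; outside)
open import Data.Fin.Subset.Properties using (_∈?_; ∣⁅x⁆∣≡1; x∈⁅y⁆⇔x≡y; drop-there)
open import Data.Integer using (ℤ; +_; _+_; _-_; _*_)
import Data.Integer.Properties as ℤ
open import Data.Integer.Tactic.RingSolver renaming (solve-∀ to solveℤ-∀)
open import Data.List using (List; []; _∷_; _++_; map; length; filter; allFin; tabulate; cartesianProduct; lookup)
open import Data.List.Membership.Propositional using () renaming (_∈_ to _∈ˡ_)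
open import Data.List.Membership.Propositional.Properties using (∈-lookup; ∈-allFin; ∈-filter⁺; ∈-filter⁻; ∈-cartesianProduct⁺)
open import Data.List.Properties using (length-tabulate; map-++; map-cong; map-tabulate; map-∘)
open import Data.List.Relation.Binary.Permutation.Propositional using (_↭_; ↭-refl; ↭-sym; ↭-trans; prep; swap)
open import Data.List.Relation.Binary.Permutation.Propositional.Properties using (∈-resp-↭)
open import Data.List.Relation.Unary.All as All using ([]; _∷_)
open import Data.List.Relation.Unary.AllPairs using ([]; _∷_)
open import Data.List.Relation.Unary.Any as Any using (here; there)
open import Data.List.Relation.Unary.Any.Properties using (lookup-index)
open import Data.List.Relation.Unary.Unique.Propositional using (Unique)
import Data.List.Relation.Unary.Unique.Propositional.Properties as Unique
open import Data.Nat using (ℕ; _≥_)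
import Data.Nat as ℕ
open import Data.Nat.ListAction using (sum)
open import Data.Nat.ListAction.Properties using (sum-++)
import Data.Nat.Properties as ℕ
open import Data.Nat.Tactic.RingSolver using (solve-∀)
open import Data.Product using (_×_; _,_; ∃-syntax; proj₁; proj₂)
open import Data.Rational using (_/_)
open import Data.Rational.Properties using (fromℚᵘ-cong)
open import Data.Rational.Unnormalised using (mkℚᵘ; *≡*)
open import Data.Sum as Sum using (_⊎_; inj₁; inj₂)
open import Data.Sum.Properties using (inj₁-injective; inj₂-injective)
open import Data.Vec using ([]; _∷_; here; there)
open import Function using (_∘_; id; _⇔_; mk⇔; Equivalence)
open import Function.Bundles using (Bijection)
open import Function.Definitions using (Injective)
open import Relation.Binary using (Setoid; Tri; tri<; tri≈; tri>)
open import Relation.Binary.PropositionalEquality using (_≡_; _≢_; refl; sym; trans; cong; cong₂; subst; setoid; ≢-sym; module ≡-Reasoning)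
open import Relation.Nullary using (¬_; Dec; yes; no; does; contradiction)
open import Relation.Nullary.Decidable using (_×-dec_; ¬?; dec-true; dec-false; from-yes)
open import Relation.Unary using (Decidable)
open import Defs
open Equivalence using (to; from)

-- Finite sums and indicators

∑ : ∀ {A : Set} → List A → (A → ℕ) → ℕ
∑ xs f = sum (map f xs)

syntax ∑ xs (λ x → e) = ∑[ x ← xs ] e

ι : ∀ {P : Set} → Dec P → ℕ
ι P? = if does P? then 1 else 0

ι-true : ∀ {P : Set} (P? : Dec P) → P → ι P? ≡ 1
ι-true P? p = cong (if_then 1 else 0) (dec-true P? p)

ι-false : ∀ {P : Set} (P? : Dec P) → ¬ P → ι P? ≡ 0
ι-false P? ¬p = cong (if_then 1 else 0) (dec-false P? ¬p)

ι-cong : ∀ {P Q : Set} (P? : Dec P) (Q? : Dec Q) → (P → Q) → (Q → P) → ι P? ≡ ι Q?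
ι-cong P? (yes q) f g = ι-true P? (g q)
ι-cong P? (no ¬q) f g = ι-false P? (¬q ∘ f)

module _ {A : Set} where

  ∑-cong : ∀ (xs : List A) {f g} → (∀ x → f x ≡ g x) → ∑ xs f ≡ ∑ xs g
  ∑-cong xs f≗g = cong sum (map-cong f≗g xs)

  ∑-distrib-+ : ∀ (xs : List A) f g → ∑[ x ← xs ] (f x ℕ.+ g x) ≡ ∑ xs f ℕ.+ ∑ xs g
  ∑-distrib-+ []       f g = refl
  ∑-distrib-+ (x ∷ xs) f g = begin
    (f x ℕ.+ g x) ℕ.+ ∑ xs (λ y → f y ℕ.+ g y)      ≡⟨ cong (f x ℕ.+ g x ℕ.+_) (∑-distrib-+ xs f g) ⟩
    (f x ℕ.+ g x) ℕ.+ (∑ xs f ℕ.+ ∑ xs g)           ≡⟨ interchange (f x) (g x) _ _ ⟩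
    (f x ℕ.+ ∑ xs f) ℕ.+ (g x ℕ.+ ∑ xs g)           ∎
    where
    open ≡-Reasoning
    interchange : ∀ a b c d → (a ℕ.+ b) ℕ.+ (c ℕ.+ d) ≡ (a ℕ.+ c) ℕ.+ (b ℕ.+ d)
    interchange = solve-∀

  ∑-distribʳ-* : ∀ (xs : List A) f k → ∑[ x ← xs ] (f x ℕ.* k) ≡ ∑ xs f ℕ.* k
  ∑-distribʳ-* []       f k = refl
  ∑-distribʳ-* (x ∷ xs) f k =
    trans (cong (f x ℕ.* k ℕ.+_) (∑-distribʳ-* xs f k)) (sym (ℕ.*-distribʳ-+ k (f x) (∑ xs f)))

  ∑-const : ∀ (xs : List A) k → ∑[ _ ← xs ] k ≡ length xs ℕ.* k
  ∑-const []       k = refl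
  ∑-const (_ ∷ xs) k = cong (k ℕ.+_) (∑-const xs k)

  length-filter≡∑ : ∀ {P : A → Set} (P? : Decidable P) xs → length (filter P? xs) ≡ ∑[ x ← xs ] ι (P? x)
  length-filter≡∑ P? []       = refl
  length-filter≡∑ P? (x ∷ xs) with P? x
  ... | yes _ = cong ℕ.suc (length-filter≡∑ P? xs)
  ... | no _  = length-filter≡∑ P? xs

∑-swap : ∀ {A B : Set} (xs : List A) (ys : List B) (f : A → B → ℕ) →
         ∑[ x ← xs ] ∑[ y ← ys ] f x y ≡ ∑[ y ← ys ] ∑[ x ← xs ] f x y
∑-swap []       ys f = sym (trans (∑-const ys 0) (ℕ.*-zeroʳ (length ys)))
∑-swap (x ∷ xs) ys f = trans (cong (∑ ys (f x) ℕ.+_) (∑-swap xs ys f)) (sym (∑-distrib-+ ys (f x) (λ y → ∑[ x′ ← xs ] f x′ y)))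

∑-cartesianProduct : ∀ {A B : Set} (xs : List A) (ys : List B) f →
                     ∑ (cartesianProduct xs ys) f ≡ ∑[ x ← xs ] ∑[ y ← ys ] f (x , y)
∑-cartesianProduct []       ys f = refl
∑-cartesianProduct (x ∷ xs) ys f = begin
  sum (map f (map (x ,_) ys ++ cartesianProduct xs ys))
    ≡⟨ cong sum (map-++ f (map (x ,_) ys) _) ⟩
  sum (map f (map (x ,_) ys) ++ map f (cartesianProduct xs ys))
    ≡⟨ sum-++ (map f (map (x ,_) ys)) _ ⟩
  ∑ (map (x ,_) ys) f ℕ.+ ∑ (cartesianProduct xs ys) f
    ≡⟨ cong₂ ℕ._+_ (cong sum (sym (map-∘ ys))) (∑-cartesianProduct xs ys f) ⟩
  ∑[ y ← ys ] f (x , y) ℕ.+ ∑[ x′ ← xs ] ∑[ y ← ys ] f (x′ , y) ∎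
  where
  open ≡-Reasoning

∑-allFin-const : ∀ n k → ∑[ _ ← allFin n ] k ≡ n ℕ.* k
∑-allFin-const n k = trans (∑-const (allFin n) k) (cong (ℕ._* k) (length-tabulate {n = n} id))

∣p∣≡∑ : ∀ {n} (p : Subset n) → ∣ p ∣ ≡ ∑[ x ← allFin n ] ι (x ∈? p)
∣p∣≡∑ []      = refl
∣p∣≡∑ {ℕ.suc n} (b ∷ p) = trans (head b) (cong (ι (zero ∈? (b ∷ p)) ℕ.+_) tail)
  where
  head : ∀ b → ∣ b ∷ p ∣ ≡ ι (zero ∈? (b ∷ p)) ℕ.+ ∣ p ∣
  head inside  = refl
  head outside = refl
  tail : ∣ p ∣ ≡ ∑[ x ← tabulate suc ] ι (x ∈? (b ∷ p))
  tail = begin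
    ∣ p ∣                                    ≡⟨ ∣p∣≡∑ p ⟩
    ∑[ x ← allFin n ] ι (x ∈? p)             ≡⟨ ∑-cong (allFin n) (λ x → ι-cong (x ∈? p) (suc x ∈? (b ∷ p)) there drop-there) ⟩
    ∑[ x ← allFin n ] ι (suc x ∈? (b ∷ p))   ≡⟨ cong sum (map-∘ (allFin n)) ⟩
    ∑ (map suc (allFin n)) (λ x → ι (x ∈? (b ∷ p)))
      ≡⟨ cong (λ xs → ∑ xs (λ x → ι (x ∈? (b ∷ p)))) (map-tabulate id suc) ⟩
    ∑[ x ← tabulate suc ] ι (x ∈? (b ∷ p)) ∎
    where open ≡-Reasoning

-- Equality with `y` is membership in the singleton `⁅ y ⁆`, whose cardinality is known.
∑-≟ : ∀ {n} (y : Fin n) → ∑[ x ← allFin n ] ι (x ≟ y) ≡ 1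
∑-≟ {n} y = begin
  ∑[ x ← allFin n ] ι (x ≟ y)      ≡⟨ ∑-cong (allFin n) (λ x → ι-cong (x ≟ y) (x ∈? ⁅ y ⁆) (from x∈⁅y⁆⇔x≡y) (to x∈⁅y⁆⇔x≡y)) ⟩
  ∑[ x ← allFin n ] ι (x ∈? ⁅ y ⁆) ≡⟨ ∣p∣≡∑ ⁅ y ⁆ ⟨
  ∣ ⁅ y ⁆ ∣                        ≡⟨ ∣⁅x⁆∣≡1 y ⟩
  1                                ∎
  where
  open ≡-Reasoning

-- Sums over triples and relations invariant under permutation

module _ {n : ℕ} where

  ∑³ : (Fin n → Fin n → Fin n → ℕ) → ℕ
  ∑³ f = ∑[ x ← allFin n ] ∑[ y ← allFin n ] ∑[ z ← allFin n ] f x y z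

  ∑³-cong : ∀ {f g} → (∀ x y z → f x y z ≡ g x y z) → ∑³ f ≡ ∑³ g
  ∑³-cong f≗g = ∑-cong (allFin n) λ x → ∑-cong (allFin n) λ y → ∑-cong (allFin n) (f≗g x y)

  ∑³-distrib-+ : ∀ f g → ∑³ (λ x y z → f x y z ℕ.+ g x y z) ≡ ∑³ f ℕ.+ ∑³ g
  ∑³-distrib-+ f g =
    trans (∑-cong (allFin n) λ x →
             trans (∑-cong (allFin n) λ y → ∑-distrib-+ (allFin n) (f x y) (g x y))
                   (∑-distrib-+ (allFin n) _ _))
          (∑-distrib-+ (allFin n) _ _)

  ∑³-swap₁₂ : ∀ f → ∑³ (λ x y z → f y x z) ≡ ∑³ f
  ∑³-swap₁₂ f = ∑-swap (allFin n) (allFin n) λ x y → ∑[ z ← allFin n ] f y x z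

  ∑³-swap₂₃ : ∀ f → ∑³ (λ x y z → f x z y) ≡ ∑³ f
  ∑³-swap₂₃ f = ∑-cong (allFin n) λ x → ∑-swap (allFin n) (allFin n) λ y z → f x z y

  module _ {R : Fin n → Fin n → Fin n → Set} (R? : ∀ x y z → Dec (R x y z))
    (swap : ∀ {x y z} → R x y z → R y x z) (rotate : ∀ {x y z} → R x y z → R y z x)
    (distinct : ∀ {x y z} → R x y z → x ≢ y) where

    private
      ordered? : ∀ x y z → Dec (x <ᶠ y × R x y z)
      ordered? x y z = (x <ᶠ? y) ×-dec R? x y z

      sorted? : ∀ x y z → Dec (x <ᶠ y × y <ᶠ z × R x y z)
      sorted? x y z = (x <ᶠ? y) ×-dec ((y <ᶠ? z) ×-dec R? x y z)

      open ≡-Reasoning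

      swap₂₃ : ∀ {x y z} → R x y z → R x z y
      swap₂₃ = swap ∘ rotate ∘ rotate

      -- The two orders of `x` and `y` exclude each other, `distinct` rules out a tie, and `swap`
      -- carries `R` from one order to the other.
      split-ordered : ∀ x y z → ι (R? x y z) ≡ ι (ordered? x y z) ℕ.+ ι (ordered? y x z)
      split-ordered x y z = split (R? x y z) (Fin.<-cmp x y)
        where
        split : Dec (R x y z) → Tri (x <ᶠ y) (x ≡ y) (y <ᶠ x) →
                ι (R? x y z) ≡ ι (ordered? x y z) ℕ.+ ι (ordered? y x z)
        split (no ¬r) _ = begin
          ι (R? x y z) ≡⟨ ι-false (R? x y z) ¬r ⟩
          0            ≡⟨ cong₂ ℕ._+_ (ι-false (ordered? x y z) (¬r ∘ proj₂)) (ι-false (ordered? y x z) (¬r ∘ swap ∘ proj₂)) ⟨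
          _            ∎
        split (yes r) (tri< x<y _ x≯y) = begin
          ι (R? x y z) ≡⟨ ι-true (R? x y z) r ⟩
          1            ≡⟨ cong₂ ℕ._+_ (ι-true (ordered? x y z) (x<y , r)) (ι-false (ordered? y x z) (x≯y ∘ proj₁)) ⟨
          _            ∎
        split (yes r) (tri≈ _ x≡y _) = contradiction x≡y (distinct r)
        split (yes r) (tri> x≮y _ x>y) = begin
          ι (R? x y z) ≡⟨ ι-true (R? x y z) r ⟩
          1            ≡⟨ cong₂ ℕ._+_ (ι-false (ordered? x y z) (x≮y ∘ proj₁)) (ι-true (ordered? y x z) (x>y , swap r)) ⟨
          _            ∎

      -- Once `x` is below `y`, the third entry lies above both, between them or below both. Ties
      -- are excluded by rotating the triple until the equal entries come first.
      split-sorted : ∀ x y z →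
        ι (ordered? x y z) ≡ ι (sorted? x y z) ℕ.+ (ι (sorted? x z y) ℕ.+ ι (sorted? z x y))
      split-sorted x y z = split (ordered? x y z) (Fin.<-cmp y z) (Fin.<-cmp x z)
        where
        -- Replaces each indicator by its numeral, so that what remains is closed by `refl`.
        sum₄ : ∀ {a b c d a′ b′ c′ d′} → a ≡ a′ → b ≡ b′ → c ≡ c′ → d ≡ d′ →
               a′ ≡ b′ ℕ.+ (c′ ℕ.+ d′) → a ≡ b ℕ.+ (c ℕ.+ d)
        sum₄ refl refl refl refl eq = eq
        split : Dec (x <ᶠ y × R x y z) → Tri (y <ᶠ z) (y ≡ z) (z <ᶠ y) → Tri (x <ᶠ z) (x ≡ z) (z <ᶠ x) →
                ι (ordered? x y z) ≡ ι (sorted? x y z) ℕ.+ (ι (sorted? x z y) ℕ.+ ι (sorted? z x y))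
        split (no ¬o) _ _ =
          sum₄ (ι-false (ordered? x y z) ¬o)
               (ι-false (sorted? x y z) λ (x<y , _ , r) → ¬o (x<y , r))
               (ι-false (sorted? x z y) λ (x<z , z<y , r) → ¬o (Fin.<-trans x<z z<y , swap₂₃ r))
               (ι-false (sorted? z x y) λ (_ , x<y , r) → ¬o (x<y , rotate r)) refl
        split (yes (x<y , r)) (tri≈ _ y≡z _) _ = contradiction y≡z (distinct (rotate r))
        split (yes (x<y , r)) (tri< y<z _ _) _ =
          sum₄ (ι-true (ordered? x y z) (x<y , r))
               (ι-true (sorted? x y z) (x<y , y<z , r))
               (ι-false (sorted? x z y) λ (_ , z<y , _) → Fin.<-asym y<z z<y)
               (ι-false (sorted? z x y) λ (z<x , _) → Fin.<-asym (Fin.<-trans x<y y<z) z<x) refl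
        split (yes (x<y , r)) (tri> _ _ _) (tri≈ _ x≡z _) = contradiction (sym x≡z) (distinct (rotate (rotate r)))
        split (yes (x<y , r)) (tri> y≮z _ z<y) (tri< x<z _ x≯z) =
          sum₄ (ι-true (ordered? x y z) (x<y , r))
               (ι-false (sorted? x y z) λ (_ , y<z , _) → y≮z y<z)
               (ι-true (sorted? x z y) (x<z , z<y , swap₂₃ r))
               (ι-false (sorted? z x y) λ (z<x , _) → x≯z z<x) refl
        split (yes (x<y , r)) (tri> y≮z _ _) (tri> x≮z _ z<x) =
          sum₄ (ι-true (ordered? x y z) (x<y , r))
               (ι-false (sorted? x y z) λ (_ , y<z , _) → y≮z y<z)
               (ι-false (sorted? x z y) λ (x<z , _) → x≮z x<z)
               (ι-true (sorted? z x y) (z<x , x<y , rotate (rotate r))) refl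

    -- The factor 6 arises as 2 times 3: two orders of the first pair, then three positions of the
    -- last entry. Renaming summation variables makes the pieces of each splitting equal.
    ∑³-sorted : ∑³ (λ x y z → ι (R? x y z)) ≡ 6 ℕ.* ∑³ (λ x y z → ι (sorted? x y z))
    ∑³-sorted = begin
      ∑³ (λ x y z → ι (R? x y z))
        ≡⟨ ∑³-cong split-ordered ⟩
      ∑³ (λ x y z → O x y z ℕ.+ O y x z)
        ≡⟨ ∑³-distrib-+ O _ ⟩
      ∑³ O ℕ.+ ∑³ (λ x y z → O y x z)
        ≡⟨ cong (∑³ O ℕ.+_) (∑³-swap₁₂ O) ⟩
      ∑³ O ℕ.+ ∑³ O
        ≡⟨ cong (λ k → k ℕ.+ k) O≡3S ⟩
      (∑³ S ℕ.+ (∑³ S ℕ.+ ∑³ S)) ℕ.+ (∑³ S ℕ.+ (∑³ S ℕ.+ ∑³ S))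
        ≡⟨ arith (∑³ S) ⟩
      6 ℕ.* ∑³ S ∎
      where
      O S : Fin n → Fin n → Fin n → ℕ
      O x y z = ι (ordered? x y z)
      S x y z = ι (sorted? x y z)
      arith : ∀ k → (k ℕ.+ (k ℕ.+ k)) ℕ.+ (k ℕ.+ (k ℕ.+ k)) ≡ 6 ℕ.* k
      arith = solve-∀
      O≡3S : ∑³ O ≡ ∑³ S ℕ.+ (∑³ S ℕ.+ ∑³ S)
      O≡3S = begin
        ∑³ O
          ≡⟨ ∑³-cong split-sorted ⟩
        ∑³ (λ x y z → S x y z ℕ.+ (S x z y ℕ.+ S z x y))
          ≡⟨ trans (∑³-distrib-+ S _) (cong (∑³ S ℕ.+_) (∑³-distrib-+ _ _)) ⟩
        ∑³ S ℕ.+ (∑³ (λ x y z → S x z y) ℕ.+ ∑³ (λ x y z → S z x y))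
          -- The cyclic renaming in the last summand is a product of two transpositions.
          ≡⟨ cong (∑³ S ℕ.+_) (cong₂ ℕ._+_ (∑³-swap₂₃ S)
               (trans (∑³-swap₂₃ (λ x z y → S z x y)) (∑³-swap₁₂ S))) ⟩
        ∑³ S ℕ.+ (∑³ S ℕ.+ ∑³ S) ∎

-- Noncollinear triangles of an incidence structure

module _ {v n : ℕ} (I : IncidenceStructure v n) where
  open IncidenceStructure I
  open Graph (pointGraph I)

  Collinear : Fin v → Fin v → Fin v → Set
  Collinear p q z = ∃[ b ] (p ∈ block b × q ∈ block b × z ∈ block b)

  -- The adjacencies are oriented cyclically, so that a rotation only permutes the components.
  Triangle : Fin v → Fin v → Fin v → Set
  Triangle p q z = p ~ q × q ~ z × z ~ p × ¬ Collinear p q z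

  triangle? : ∀ p q z → Dec (Triangle p q z)
  triangle? p q z = (p ~? q) ×-dec ((q ~? z) ×-dec ((z ~? p) ×-dec
    ¬? (any? λ b → (p ∈? block b) ×-dec ((q ∈? block b) ×-dec (z ∈? block b)))))

  Triangle-swap : ∀ {p q z} → Triangle p q z → Triangle q p z
  Triangle-swap {p} {q} {z} (p~q , q~z , z~p , ¬c) =
    ~-sym {p} {q} p~q , ~-sym {z} {p} z~p , ~-sym {q} {z} q~z , λ (b , q∈b , p∈b , z∈b) → ¬c (b , p∈b , q∈b , z∈b)

  Triangle-rotate : ∀ {p q z} → Triangle p q z → Triangle q z p
  Triangle-rotate (p~q , q~z , z~p , ¬c) =
    q~z , z~p , p~q , λ (b , q∈b , z∈b , p∈b) → ¬c (b , p∈b , q∈b , z∈b)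

  SortedTriangle : Fin v × Fin v × Fin v → Set
  SortedTriangle (p , q , z) = p <ᶠ q × q <ᶠ z × Triangle p q z

  sortedTriangle? : Decidable SortedTriangle
  sortedTriangle? (p , q , z) = (p <ᶠ? q) ×-dec ((q <ᶠ? z) ×-dec triangle? p q z)

  sortedTriangles : List (Fin v × Fin v × Fin v)
  sortedTriangles = filter sortedTriangle? (cartesianProduct (allFin v) (cartesianProduct (allFin v) (allFin v)))

  -- Triangles are invariant under all permutations of their points, so `∑³-sorted` applies; the
  -- sorted sum is then folded back into the length of the filtered product list.
  triangles≡6*sortedTriangles : ∑³ (λ p q z → ι (triangle? p q z)) ≡ 6 ℕ.* length sortedTriangles
  triangles≡6*sortedTriangles = begin
    ∑³ (λ p q z → ι (triangle? p q z))
      ≡⟨ ∑³-sorted triangle? Triangle-swap Triangle-rotate (proj₁ ∘ proj₁) ⟩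
    6 ℕ.* ∑³ (λ p q z → ι (sortedTriangle? (p , q , z)))
      ≡⟨ cong (6 ℕ.*_) (∑-cong points λ p → ∑-cartesianProduct points points _) ⟨
    6 ℕ.* ∑[ p ← points ] ∑[ qz ← cartesianProduct points points ] ι (sortedTriangle? (p , qz))
      ≡⟨ cong (6 ℕ.*_) (∑-cartesianProduct points (cartesianProduct points points) _) ⟨
    6 ℕ.* ∑[ t ← cartesianProduct points (cartesianProduct points points) ] ι (sortedTriangle? t)
      ≡⟨ cong (6 ℕ.*_) (length-filter≡∑ sortedTriangle? (cartesianProduct points (cartesianProduct points points))) ⟨
    6 ℕ.* length sortedTriangles ∎
    where
    open ≡-Reasoning
    points = allFin v

  -- Double counting with strong regularity

  module _ {s t r lam μ : ℕ} {α : Fin r → ℕ} (srpg : IsSRPG I s t α lam μ) where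
    open IsSRPG srpg
    open IsPG isPG
    open IsStronglyRegular isStronglyRegular
    open ≡-Reasoning

    -- Incident point-block pairs are counted once by points and once by blocks.
    points*replication : v ℕ.* ℕ.suc t ≡ n ℕ.* ℕ.suc s
    points*replication = begin
      v ℕ.* ℕ.suc t
        ≡⟨ ∑-allFin-const v (ℕ.suc t) ⟨
      ∑[ p ← allFin v ] ℕ.suc t
        ≡⟨ ∑-cong (allFin v) (λ p → trans (sym (pointDegree p)) (length-filter≡∑ (λ b → p ∈? block b) (allFin n))) ⟩
      ∑[ p ← allFin v ] ∑[ b ← allFin n ] ι (p ∈? block b)
        ≡⟨ ∑-swap (allFin v) (allFin n) (λ p b → ι (p ∈? block b)) ⟩
      ∑[ b ← allFin n ] ∑[ p ← allFin v ] ι (p ∈? block b)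
        ≡⟨ ∑-cong (allFin n) (λ b → trans (sym (∣p∣≡∑ (block b))) (blockSize b)) ⟩
      ∑[ b ← allFin n ] ℕ.suc s
        ≡⟨ ∑-allFin-const n (ℕ.suc s) ⟩
      n ℕ.* ℕ.suc s ∎

    -- Every point has s(t + 1) neighbours; the count of incident pairs then eliminates v and t in
    -- favour of n and s.
    adjacentPairs : ∑[ p ← allFin v ] ∑[ q ← allFin v ] ι (p ~? q) ≡ n ℕ.* ℕ.suc s ℕ.* s
    adjacentPairs = begin
      ∑[ p ← allFin v ] ∑[ q ← allFin v ] ι (p ~? q)
        ≡⟨ ∑-cong (allFin v) (λ p → trans (sym (length-filter≡∑ (p ~?_) (allFin v))) (regular p)) ⟩
      ∑[ p ← allFin v ] (s ℕ.* ℕ.suc t)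
        ≡⟨ ∑-allFin-const v (s ℕ.* ℕ.suc t) ⟩
      v ℕ.* (s ℕ.* ℕ.suc t)
        ≡⟨ arith v s (ℕ.suc t) ⟩
      v ℕ.* ℕ.suc t ℕ.* s
        ≡⟨ cong (ℕ._* s) points*replication ⟩
      n ℕ.* ℕ.suc s ℕ.* s ∎
      where
      arith : ∀ a b c → a ℕ.* (b ℕ.* c) ≡ a ℕ.* c ℕ.* b
      arith = solve-∀

    -- A common neighbour z of p and q either forms a triangle with them or
    -- lies on the block b; the two endpoints make up for the rest of b.
    commonNeighbour-split : ∀ {p q b} → p ≢ q → p ∈ block b → q ∈ block b → ∀ z →
      ι ((p ~? z) ×-dec (q ~? z)) ℕ.+ (ι (z ≟ p) ℕ.+ ι (z ≟ q)) ≡ ι (triangle? p q z) ℕ.+ ι (z ∈? block b)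
    commonNeighbour-split {p} {q} {b} p≢q p∈b q∈b z = split (z ≟ p) (z ≟ q) (z ∈? block b)
      where
      combine : ∀ {a b c d e a′ b′ c′ d′ e′} → a ≡ a′ → b ≡ b′ → c ≡ c′ → d ≡ d′ → e ≡ e′ →
                a′ ℕ.+ (b′ ℕ.+ c′) ≡ d′ ℕ.+ e′ → a ℕ.+ (b ℕ.+ c) ≡ d ℕ.+ e
      combine refl refl refl refl refl eq = eq
      common? : Dec (p ~ z × q ~ z)
      common? = (p ~? z) ×-dec (q ~? z)
      split : Dec (z ≡ p) → Dec (z ≡ q) → Dec (z ∈ block b) →
        ι common? ℕ.+ (ι (z ≟ p) ℕ.+ ι (z ≟ q)) ≡ ι (triangle? p q z) ℕ.+ ι (z ∈? block b)
      split (yes z≡p) _ _ =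
        combine (ι-false common? λ ((p≢z , _) , _) → p≢z (sym z≡p))
                (ι-true (z ≟ p) z≡p)
                (ι-false (z ≟ q) λ z≡q → p≢q (trans (sym z≡p) z≡q))
                (ι-false (triangle? p q z) λ (_ , _ , (z≢p , _) , _) → z≢p z≡p)
                (ι-true (z ∈? block b) (subst (_∈ block b) (sym z≡p) p∈b)) refl
      split (no z≢p) (yes z≡q) _ =
        combine (ι-false common? λ (_ , (q≢z , _)) → q≢z (sym z≡q))
                (ι-false (z ≟ p) z≢p)
                (ι-true (z ≟ q) z≡q)
                (ι-false (triangle? p q z) λ (_ , (q≢z , _) , _) → q≢z (sym z≡q))
                (ι-true (z ∈? block b) (subst (_∈ block b) (sym z≡q) q∈b)) refl
      split (no z≢p) (no z≢q) (yes z∈b) =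
        combine (ι-true common? ((z≢p ∘ sym , b , p∈b , z∈b) , (z≢q ∘ sym , b , q∈b , z∈b)))
                (ι-false (z ≟ p) z≢p)
                (ι-false (z ≟ q) z≢q)
                (ι-false (triangle? p q z) λ (_ , _ , _ , ¬c) → ¬c (b , p∈b , q∈b , z∈b))
                (ι-true (z ∈? block b) z∈b) refl
      split (no z≢p) (no z≢q) (no z∉b) =
        combine (ι-cong common? (triangle? p q z)
                   (λ (p~z , q~z) → (p≢q , b , p∈b , q∈b) , q~z , ~-sym {p} {z} p~z ,
                      -- A block through all three points shares `p` and `q` with `b`, hence is `b`,
                      -- which misses `z`.
                      λ (c , p∈c , q∈c , z∈c) →
                        z∉b (subst (λ d → z ∈ block d) (atMostOneBlock p≢q p∈c q∈c p∈b q∈b) z∈c))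
                   (λ (_ , q~z , z~p , _) → ~-sym {z} {p} z~p , q~z))
                (ι-false (z ≟ p) z≢p)
                (ι-false (z ≟ q) z≢q)
                refl
                (ι-false (z ∈? block b) z∉b) refl

    -- An edge lies on λ - s + 1 triangles. The term s is moved to the other side to avoid truncated
    -- subtraction, and the indicator makes the identity valid for all pairs, ready for summation.
    trianglesOnEdge : ∀ p q →
      ι (p ~? q) ℕ.* ℕ.suc lam ≡ ∑[ z ← allFin v ] ι (triangle? p q z) ℕ.+ ι (p ~? q) ℕ.* s
    trianglesOnEdge p q = split (p ~? q)
      where
      T : Fin v → ℕ
      T z = ι (triangle? p q z)
      split : Dec (p ~ q) → ι (p ~? q) ℕ.* ℕ.suc lam ≡ ∑ (allFin v) T ℕ.+ ι (p ~? q) ℕ.* s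
      split (no p≁q) = begin
        ι (p ~? q) ℕ.* ℕ.suc lam                 ≡⟨ cong (ℕ._* ℕ.suc lam) p≁q≡0 ⟩
        0                                        ≡⟨ trans (∑-allFin-const v 0) (ℕ.*-zeroʳ v) ⟨
        ∑[ _ ← allFin v ] 0                      ≡⟨ ℕ.+-identityʳ _ ⟨
        ∑[ _ ← allFin v ] 0 ℕ.+ 0 ℕ.* s          ≡⟨ cong₂ (λ a b → a ℕ.+ b ℕ.* s) (∑-cong (allFin v) (λ z → ι-false (triangle? p q z) (p≁q ∘ proj₁))) p≁q≡0 ⟨
        ∑ (allFin v) T ℕ.+ ι (p ~? q) ℕ.* s      ∎
        where
        p≁q≡0 : ι (p ~? q) ≡ 0
        p≁q≡0 = ι-false (p ~? q) p≁q
      split (yes p~q@(p≢q , b , p∈b , q∈b)) = begin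
        ι (p ~? q) ℕ.* ℕ.suc lam            ≡⟨ cong (ℕ._* ℕ.suc lam) p~q≡1 ⟩
        1 ℕ.* ℕ.suc lam                     ≡⟨ ℕ.*-identityˡ _ ⟩
        ℕ.suc lam                           ≡⟨ ℕ.suc-injective lam+2 ⟩
        ∑ (allFin v) T ℕ.+ s                ≡⟨ cong (∑ (allFin v) T ℕ.+_) (ℕ.*-identityˡ s) ⟨
        ∑ (allFin v) T ℕ.+ 1 ℕ.* s          ≡⟨ cong (λ k → ∑ (allFin v) T ℕ.+ k ℕ.* s) p~q≡1 ⟨
        ∑ (allFin v) T ℕ.+ ι (p ~? q) ℕ.* s ∎
        where
        p~q≡1 : ι (p ~? q) ≡ 1
        p~q≡1 = ι-true (p ~? q) p~q
        C P Q B : Fin v → ℕ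
        C z = ι ((p ~? z) ×-dec (q ~? z))
        P z = ι (z ≟ p)
        Q z = ι (z ≟ q)
        B z = ι (z ∈? block b)
        -- Summation of `commonNeighbour-split` over z: the λ common neighbours and the two
        -- endpoints balance the triangles and the s + 1 points of `b`.
        lam+2 : ℕ.suc (ℕ.suc lam) ≡ ℕ.suc (∑ (allFin v) T ℕ.+ s)
        lam+2 = begin
          2 ℕ.+ lam
            ≡⟨ ℕ.+-comm 2 lam ⟩
          lam ℕ.+ 2
            ≡⟨ cong₂ ℕ._+_ (trans (sym (length-filter≡∑ (λ z → (p ~? z) ×-dec (q ~? z)) (allFin v))) (adjacent p q p~q))
                           (cong₂ ℕ._+_ (∑-≟ p) (∑-≟ q)) ⟨
          ∑ (allFin v) C ℕ.+ (∑ (allFin v) P ℕ.+ ∑ (allFin v) Q)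
            ≡⟨ cong (∑ (allFin v) C ℕ.+_) (∑-distrib-+ (allFin v) P Q) ⟨
          ∑ (allFin v) C ℕ.+ ∑[ z ← allFin v ] (P z ℕ.+ Q z)
            ≡⟨ ∑-distrib-+ (allFin v) C _ ⟨
          ∑[ z ← allFin v ] (C z ℕ.+ (P z ℕ.+ Q z))
            ≡⟨ ∑-cong (allFin v) (commonNeighbour-split p≢q p∈b q∈b) ⟩
          ∑[ z ← allFin v ] (T z ℕ.+ B z)
            ≡⟨ ∑-distrib-+ (allFin v) T B ⟩
          ∑ (allFin v) T ℕ.+ ∑ (allFin v) B
            ≡⟨ cong (∑ (allFin v) T ℕ.+_) (trans (sym (∣p∣≡∑ (block b))) (blockSize b)) ⟩
          ∑ (allFin v) T ℕ.+ ℕ.suc s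
            ≡⟨ ℕ.+-suc (∑ (allFin v) T) s ⟩
          ℕ.suc (∑ (allFin v) T ℕ.+ s) ∎

    -- `trianglesOnEdge` is summed over all ordered pairs; both indicator sums become
    -- `adjacentPairs`.
    sortedTriangles-count :
      n ℕ.* ℕ.suc s ℕ.* s ℕ.* ℕ.suc lam ≡ 6 ℕ.* length sortedTriangles ℕ.+ n ℕ.* ℕ.suc s ℕ.* s ℕ.* s
    sortedTriangles-count = begin
      n ℕ.* ℕ.suc s ℕ.* s ℕ.* ℕ.suc lam
        ≡⟨ cong (ℕ._* ℕ.suc lam) adjacentPairs ⟨
      (∑[ p ← allFin v ] ∑[ q ← allFin v ] ι (p ~? q)) ℕ.* ℕ.suc lam
        ≡⟨ ∑∑-distribʳ-* (ℕ.suc lam) ⟨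
      ∑[ p ← allFin v ] ∑[ q ← allFin v ] (ι (p ~? q) ℕ.* ℕ.suc lam)
        ≡⟨ ∑-cong (allFin v) (λ p → trans (∑-cong (allFin v) (trianglesOnEdge p)) (∑-distrib-+ (allFin v) _ _)) ⟩
      ∑[ p ← allFin v ] ((∑[ q ← allFin v ] ∑[ z ← allFin v ] ι (triangle? p q z))
                         ℕ.+ ∑[ q ← allFin v ] (ι (p ~? q) ℕ.* s))
        ≡⟨ ∑-distrib-+ (allFin v) _ _ ⟩
      ∑³ (λ p q z → ι (triangle? p q z)) ℕ.+ ∑[ p ← allFin v ] ∑[ q ← allFin v ] (ι (p ~? q) ℕ.* s)
        ≡⟨ cong₂ ℕ._+_ triangles≡6*sortedTriangles (trans (∑∑-distribʳ-* s) (cong (ℕ._* s) adjacentPairs)) ⟩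
      6 ℕ.* length sortedTriangles ℕ.+ n ℕ.* ℕ.suc s ℕ.* s ℕ.* s ∎
      where
      ∑∑-distribʳ-* : ∀ k → ∑[ p ← allFin v ] ∑[ q ← allFin v ] (ι (p ~? q) ℕ.* k) ≡
                            (∑[ p ← allFin v ] ∑[ q ← allFin v ] ι (p ~? q)) ℕ.* k
      ∑∑-distribʳ-* k =
        trans (∑-cong (allFin v) λ p → ∑-distribʳ-* (allFin v) (λ q → ι (p ~? q)) k)
              (∑-distribʳ-* (allFin v) _ k)

-- Cycles of length six

lookup-injective : ∀ {A : Set} {xs : List A} → Unique xs → Injective _≡_ _≡_ (lookup xs)
lookup-injective (_    ∷ _)  {zero}  {zero}  _  = refl
lookup-injective (x∉xs ∷ _)  {zero}  {suc j} eq = contradiction eq (All.lookup x∉xs (∈-lookup j))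
lookup-injective (x∉xs ∷ _)  {suc i} {zero}  eq = contradiction (sym eq) (All.lookup x∉xs (∈-lookup i))
lookup-injective (_    ∷ xs!) {suc i} {suc j} eq = cong suc (lookup-injective xs! eq)

-- Sorted triangles as canonical representatives

module _ {v n : ℕ} (I : IncidenceStructure v n) where
  open IncidenceStructure I
  open Graph (tannerGraph (incidenceMatrix I)) using (_~_; ~-sym)

  vertices : Fin v × Fin v × Fin v → List (Fin v)
  vertices (p , q , z) = p ∷ q ∷ z ∷ []

  -- Insertion sort: the first two points are compared and `z` is inserted. The permutation later
  -- transports membership in both directions.
  sortTriangle : ∀ p q z → Triangle I p q z → ∃[ t ] SortedTriangle I t × vertices t ↭ p ∷ q ∷ z ∷ []
  sortTriangle p q z pqz = sort (Fin.<-cmp p q)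
    where
    -- Generalised over `p` and `q`, to serve both orders of the first pair.
    insert : ∀ {p q} → p <ᶠ q → Triangle I p q z → Tri (p <ᶠ z) (p ≡ z) (z <ᶠ p) → Tri (q <ᶠ z) (q ≡ z) (z <ᶠ q) →
             ∃[ t ] SortedTriangle I t × vertices t ↭ p ∷ q ∷ z ∷ []
    insert p<q pqz _ (tri< q<z _ _) = _ , (p<q , q<z , pqz) , ↭-refl
    insert p<q (_ , (q≢z , _) , _) _ (tri≈ _ q≡z _) = contradiction q≡z q≢z
    insert p<q pqz (tri< p<z _ _) (tri> _ _ z<q) =
      _ , (p<z , z<q , Triangle-swap I (Triangle-rotate I (Triangle-rotate I pqz))) , prep _ (swap _ _ ↭-refl)
    insert p<q (_ , _ , (z≢p , _) , _) (tri≈ _ p≡z _) _ = contradiction (sym p≡z) z≢p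
    insert p<q pqz (tri> _ _ z<p) (tri> _ _ _) =
      _ , (z<p , p<q , Triangle-rotate I (Triangle-rotate I pqz)) , ↭-trans (swap _ _ ↭-refl) (prep _ (swap _ _ ↭-refl))
    sort : Tri (p <ᶠ q) (p ≡ q) (q <ᶠ p) → ∃[ t ] SortedTriangle I t × vertices t ↭ p ∷ q ∷ z ∷ []
    sort (tri< p<q _ _) = insert p<q pqz (Fin.<-cmp p z) (Fin.<-cmp q z)
    sort (tri≈ _ p≡q _) = contradiction p≡q (proj₁ (proj₁ pqz))
    sort (tri> _ _ q<p) with insert q<p (Triangle-swap I pqz) (Fin.<-cmp q z) (Fin.<-cmp p z)
    ... | t , sorted , perm = t , sorted , ↭-trans perm (swap _ _ ↭-refl)

  private
    least : ∀ {a b c x} → SortedTriangle I (a , b , c) → x ∈ˡ a ∷ b ∷ c ∷ [] → a ≤ᶠ x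
    least _                 (here refl)                 = ℕ.≤-refl
    least (a<b , _)         (there (here refl))         = ℕ.<⇒≤ a<b
    least (a<b , b<c , _)   (there (there (here refl))) = ℕ.<⇒≤ (Fin.<-trans a<b b<c)
    greatest : ∀ {a b c x} → SortedTriangle I (a , b , c) → x ∈ˡ a ∷ b ∷ c ∷ [] → x ≤ᶠ c
    greatest (a<b , b<c , _) (here refl)                 = ℕ.<⇒≤ (Fin.<-trans a<b b<c)
    greatest (_ , b<c , _)   (there (here refl))         = ℕ.<⇒≤ b<c
    greatest _               (there (there (here refl))) = ℕ.≤-refl

  -- The set of entries determines its least and greatest elements, and the middle entry is the only
  -- member different from both.
  sortedTriangle-unique : ∀ {t t′} → SortedTriangle I t → SortedTriangle I t′ →
                          (∀ x → x ∈ˡ vertices t ⇔ x ∈ˡ vertices t′) → t ≡ t′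
  sortedTriangle-unique {t@(a , b , c)} {t′@(a′ , b′ , c′)} st@(a<b , b<c , _) st′@(a′<b′ , b′<c′ , _) same
    with refl ← Fin.≤-antisym (least st (from (same _) (here refl))) (least st′ (to (same _) (here refl)))
       | refl ← Fin.≤-antisym (greatest st′ (to (same _) (there (there (here refl)))))
                              (greatest st (from (same _) (there (there (here refl)))))
    = cong (λ b → a , b , c) (middle (to (same b) (there (here refl))))
    where
    middle : ∀ {b′} → b ∈ˡ a ∷ b′ ∷ c ∷ [] → b ≡ b′
    middle (here b≡a)                 = contradiction (sym b≡a) (Fin.<⇒≢ a<b)
    middle (there (here b≡b′))        = b≡b′
    middle (there (there (here b≡c))) = contradiction b≡c (Fin.<⇒≢ b<c)

  sortedTriangles-unique : Unique (sortedTriangles I)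
  sortedTriangles-unique =
    Unique.filter⁺ (sortedTriangle? I)
      (Unique.cartesianProduct⁺ (Unique.allFin⁺ v) (Unique.cartesianProduct⁺ (Unique.allFin⁺ v) (Unique.allFin⁺ v)))

  ∈-sortedTriangles⁺ : ∀ {t} → SortedTriangle I t → t ∈ˡ sortedTriangles I
  ∈-sortedTriangles⁺ =
    ∈-filter⁺ (sortedTriangle? I) (∈-cartesianProduct⁺ (∈-allFin _) (∈-cartesianProduct⁺ (∈-allFin _) (∈-allFin _)))

  ∈-sortedTriangles⁻ : ∀ {t} → t ∈ˡ sortedTriangles I → SortedTriangle I t
  ∈-sortedTriangles⁻ t∈ = proj₂ (∈-filter⁻ (sortedTriangle? I) {xs = cartesianProduct (allFin v) (cartesianProduct (allFin v) (allFin v))} t∈)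

  -- Adjacency in the Tanner graph

  ~⇒∈ : ∀ {p b} → inj₁ p ~ inj₂ b → p ∈ block b
  ~⇒∈ {p} {b} p~b with p ∈? block b
  -- For `no` the matrix entry computes to `0F`, so the hypothesis is absurd and the clause may be
  -- omitted.
  ... | yes p∈b = p∈b

  ∈⇒~ : ∀ {p b} → p ∈ block b → inj₁ p ~ inj₂ b
  ∈⇒~ {p} {b} p∈b = cong (if_then 1F else 0F) (dec-true (p ∈? block b) p∈b)

  -- The endpoint `u` enters through an equation because it will be `vertex c i`, which is not in
  -- constructor form.
  point-neighbour : ∀ {p u w} → u ≡ inj₁ p → u ~ w → ∃[ b ] w ≡ inj₂ b × p ∈ block b
  point-neighbour {p} {w = inj₂ b} refl p~b = b , refl , ~⇒∈ p~b

  block-neighbour : ∀ {b u w} → u ≡ inj₂ b → u ~ w → ∃[ p ] w ≡ inj₁ p × p ∈ block b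
  block-neighbour {b} {w = inj₁ p} refl p~b = p , refl , ~⇒∈ p~b

  -- Reading a 6-cycle from one of its points

  Hexagon : Set
  Hexagon = Cycle (tannerGraph (incidenceMatrix I)) 6

  open Setoid (CycleSetoid (tannerGraph (incidenceMatrix I)) 6) using (_≈_)
  open Cycle

  Edge : Hexagon → Fin v ⊎ Fin n → Fin v ⊎ Fin n → Set
  Edge = HasEdge (tannerGraph (incidenceMatrix I)) 6

  σ : Fin 6 → Fin 6
  σ = next (tannerGraph (incidenceMatrix I)) 6

  -- Index arithmetic modulo 6 is settled by evaluating a decision procedure on all indices.
  σ⁶ : ∀ i → σ (σ (σ (σ (σ (σ i))))) ≡ i
  σ⁶ = from-yes (all? λ i → σ (σ (σ (σ (σ (σ i))))) ≟ i)

  i≢σ²i : ∀ i → i ≢ σ (σ i)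
  i≢σ²i = from-yes (all? λ i → ¬? (i ≟ σ (σ i)))

  i≢σ⁴i : ∀ i → i ≢ σ (σ (σ (σ i)))
  i≢σ⁴i = from-yes (all? λ i → ¬? (i ≟ σ (σ (σ (σ i)))))

  σ-orbit : Fin 6 → List (Fin 6)
  σ-orbit i = i ∷ σ i ∷ σ (σ i) ∷ σ (σ (σ i)) ∷ σ (σ (σ (σ i))) ∷ σ (σ (σ (σ (σ i)))) ∷ []

  σ-transitive : ∀ i j → j ∈ˡ σ-orbit i
  σ-transitive = from-yes (all? λ i → all? λ j → Any.any? (j ≟_) (σ-orbit i))

  OnHexagon : Hexagon → Fin v → Set
  OnHexagon c x = ∃[ i ] vertex c i ≡ inj₁ x

  -- The cycle p-b-q-d-z-e read forwards from index `i`. The start is arbitrary, since an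
  -- enumeration may begin at a block.
  record Walk (c : Hexagon) (i : Fin 6) (p : Fin v) : Set where
    field
      {q z}    : Fin v
      {b d e}  : Fin n
      v₀       : vertex c i ≡ inj₁ p
      v₁       : vertex c (σ i) ≡ inj₂ b
      v₂       : vertex c (σ (σ i)) ≡ inj₁ q
      v₃       : vertex c (σ (σ (σ i))) ≡ inj₂ d
      v₄       : vertex c (σ (σ (σ (σ i)))) ≡ inj₁ z
      v₅       : vertex c (σ (σ (σ (σ (σ i))))) ≡ inj₂ e
      p∈b      : p ∈ block b
      q∈b      : q ∈ block b
      q∈d      : q ∈ block d
      z∈d      : z ∈ block d
      z∈e      : z ∈ block e
      p∈e      : p ∈ block e

    p≢q : p ≢ q
    p≢q p≡q = i≢σ²i i (injective c (trans v₀ (trans (cong inj₁ p≡q) (sym v₂))))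

    q≢z : q ≢ z
    q≢z q≡z = i≢σ²i (σ (σ i)) (injective c (trans v₂ (trans (cong inj₁ q≡z) (sym v₄))))

    z≢p : z ≢ p
    z≢p z≡p = i≢σ⁴i i (injective c (trans v₀ (trans (cong inj₁ (sym z≡p)) (sym v₄))))

    b≢d : b ≢ d
    b≢d b≡d = i≢σ²i (σ i) (injective c (trans v₁ (trans (cong inj₂ b≡d) (sym v₃))))

  walk : ∀ c i {p} → vertex c i ≡ inj₁ p → Walk c i p
  walk c i v₀
    with b , v₁ , p∈b ← point-neighbour v₀ (adjacent c i)
    with q , v₂ , q∈b ← block-neighbour v₁ (adjacent c (σ i))
    with d , v₃ , q∈d ← point-neighbour v₂ (adjacent c (σ (σ i)))
    with z , v₄ , z∈d ← block-neighbour v₃ (adjacent c (σ (σ (σ i))))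
    with e , v₅ , z∈e ← point-neighbour v₄ (adjacent c (σ (σ (σ (σ i)))))
    -- Six steps return to index `i` by `σ⁶`, so `p′` is `p`.
    with p′ , v₆ , p′∈e ← block-neighbour v₅ (adjacent c (σ (σ (σ (σ (σ i))))))
    = record { v₀ = v₀ ; v₁ = v₁ ; v₂ = v₂ ; v₃ = v₃ ; v₄ = v₄ ; v₅ = v₅
             ; p∈b = p∈b ; q∈b = q∈b ; q∈d = q∈d ; z∈d = z∈d ; z∈e = z∈e
             ; p∈e = subst (_∈ block e) (inj₁-injective (trans (sym v₆) (trans (cong (vertex c) (σ⁶ i)) v₀))) p′∈e }

  module _ {c i p} (w : Walk c i p) where
    open Walk w

    -- Every index is an iterate of `σ` at `i`; the odd iterates carry blocks and cannot equal a
    -- point.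
    walk-points : ∀ {j x} → vertex c j ≡ inj₁ x → x ∈ˡ p ∷ q ∷ z ∷ []
    walk-points {j} vj with σ-transitive i j
    ... | here refl                                 = here (inj₁-injective (trans (sym vj) v₀))
    ... | there (here refl)                         = contradiction (trans (sym vj) v₁) λ ()
    ... | there (there (here refl))                 = there (here (inj₁-injective (trans (sym vj) v₂)))
    ... | there (there (there (here refl)))         = contradiction (trans (sym vj) v₃) λ ()
    ... | there (there (there (there (here refl)))) = there (there (here (inj₁-injective (trans (sym vj) v₄))))
    ... | there (there (there (there (there (here refl))))) = contradiction (trans (sym vj) v₅) λ ()

    on-walk : ∀ {x} → x ∈ˡ p ∷ q ∷ z ∷ [] → OnHexagon c x
    on-walk (here refl)                 = _ , v₀
    on-walk (there (here refl))         = _ , v₂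
    on-walk (there (there (here refl))) = _ , v₄

    walk-edge₁ : Edge c (inj₁ p) (inj₂ b)
    walk-edge₁ = i , inj₁ (sym v₀ , sym v₁)

    walk-edge₆ : Edge c (inj₁ p) (inj₂ e)
    -- The closing edge runs from `e` back to `p`, hence the reversed orientation.
    walk-edge₆ = σ (σ (σ (σ (σ i)))) , inj₂ (sym v₅ , trans (sym v₀) (cong (vertex c) (sym (σ⁶ i))))

  -- In the walk from `x`, the block `b` comes first or last, according to the orientation of the
  -- edge; the second point on it is then `q` or `z`.
  edge⇒collinear : ∀ {c x b} → Edge c (inj₁ x) (inj₂ b) →
                   OnHexagon c x × x ∈ block b × ∃[ y ] OnHexagon c y × x ≢ y × y ∈ block b
  edge⇒collinear {c} (i , inj₁ (vi , vσi))
    with w ← walk c i (sym vi)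
    with refl ← inj₂-injective (trans vσi (Walk.v₁ w))
    = (_ , Walk.v₀ w) , Walk.p∈b w , _ , (_ , Walk.v₂ w) , Walk.p≢q w , Walk.q∈b w
  edge⇒collinear {c} (i , inj₂ (vi , vσi))
    with w ← walk c (σ i) (sym vσi)
    -- The block directly before `x` is also the one reached five steps after it.
    with refl ← inj₂-injective (trans vi (trans (cong (vertex c) (sym (σ⁶ i))) (Walk.v₅ w)))
    = (_ , Walk.v₀ w) , Walk.p∈e w , _ , (_ , Walk.v₄ w) , ≢-sym (Walk.z≢p w) , Walk.z∈e w

  edge-sym : ∀ {c u w} → Edge c u w → Edge c w u
  edge-sym (i , e) = i , Sum.swap e

  edge⇒~ : ∀ {c u w} → Edge c u w → u ~ w
  edge⇒~ {c} (i , inj₁ (refl , refl)) = adjacent c i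
  edge⇒~ {c} (i , inj₂ (refl , refl)) = ~-sym {vertex c i} {vertex c (σ i)} (adjacent c i)

  -- A point of `c` lies on an edge of `c`; that edge also belongs to `d` and brings its endpoints
  -- along.
  ≈⇒points-⊆ : ∀ {c d} → c ≈ d → ∀ {x} → OnHexagon c x → OnHexagon d x
  ≈⇒points-⊆ {c} {d} c≈d {x} (i , vi) with w ← walk c i vi
    = proj₁ (edge⇒collinear {d} (to (c≈d (inj₁ x) (inj₂ (Walk.b w))) (walk-edge₁ w)))

  somePoint : ∀ c → ∃[ p ] OnHexagon c p
  somePoint c with vertex c 0F in v₀
  ... | inj₁ p = p , 0F , v₀
  ... | inj₂ b with p , v₁ , _ ← block-neighbour v₀ (adjacent c 0F) = p , 1F , v₁

  -- The blocks are the witnesses of the three adjacencies. If two of them coincided, that block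
  -- would contain all three points, against noncollinearity.
  triangleHexagon : ∀ {p q z} → Triangle I p q z → Hexagon
  triangleHexagon {p} {q} {z} ((p≢q , b , p∈b , q∈b) , (q≢z , d , q∈d , z∈d) , (z≢p , e , z∈e , p∈e) , ¬c) = record
    { vertex = lookup us
    ; injective = lookup-injective us!
    ; adjacent = λ where
        0F → ∈⇒~ p∈b
        1F → ∈⇒~ q∈b
        2F → ∈⇒~ q∈d
        3F → ∈⇒~ z∈d
        4F → ∈⇒~ z∈e
        5F → ∈⇒~ p∈e
    }
    where
    us : List (Fin v ⊎ Fin n)
    us = inj₁ p ∷ inj₂ b ∷ inj₁ q ∷ inj₂ d ∷ inj₁ z ∷ inj₂ e ∷ []
    us! : Unique us
    us! = ((λ ()) ∷ (p≢q ∘ inj₁-injective) ∷ (λ ()) ∷ (z≢p ∘ sym ∘ inj₁-injective) ∷ (λ ()) ∷ [])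
        ∷ ((λ ()) ∷ (λ { refl → ¬c (b , p∈b , q∈b , z∈d) }) ∷ (λ ()) ∷ (λ { refl → ¬c (b , p∈b , q∈b , z∈e) }) ∷ [])
        ∷ ((λ ()) ∷ (q≢z ∘ inj₁-injective) ∷ (λ ()) ∷ [])
        ∷ ((λ ()) ∷ (λ { refl → ¬c (d , p∈e , q∈d , z∈d) }) ∷ [])
        ∷ ((λ ()) ∷ [])
        ∷ []
        ∷ []

  triangleHexagon-points : ∀ {p q z} (t : Triangle I p q z) x → OnHexagon (triangleHexagon t) x ⇔ x ∈ˡ p ∷ q ∷ z ∷ []
  triangleHexagon-points t x = mk⇔
    (λ where
      (0F , refl) → here refl
      (2F , refl) → there (here refl)
      (4F , refl) → there (there (here refl))
      (5F , ()))
    (λ where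
      (here refl)                 → 0F , refl
      (there (here refl))         → 2F , refl
      (there (there (here refl))) → 4F , refl)

  -- The bijection between sorted triangles and 6-cycles

  module _ (atMostOneBlock : ∀ {p q} → p ≢ q → ∀ {b c} →
                             p ∈ block b → q ∈ block b → p ∈ block c → q ∈ block c → b ≡ c) where

    -- A 6-cycle is determined by its set of points, because two points of the
    -- cycle lying on a block b are consecutive on it, with b between them.
    collinear⇒edge : ∀ {c x y b} → OnHexagon c x → OnHexagon c y → x ≢ y → x ∈ block b → y ∈ block b →
                     Edge c (inj₁ x) (inj₂ b)
    collinear⇒edge {c} {x} {b = b} (i , vi) (j , vj) x≢y x∈b y∈b with w ← walk c i vi with walk-points w vj
    ... | here refl = contradiction refl x≢y
    ... | there (here refl) =
      subst (λ b → Edge c (inj₁ x) (inj₂ b)) (atMostOneBlock x≢y (Walk.p∈b w) (Walk.q∈b w) x∈b y∈b) (walk-edge₁ w)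
    ... | there (there (here refl)) =
      subst (λ b → Edge c (inj₁ x) (inj₂ b)) (atMostOneBlock x≢y (Walk.p∈e w) (Walk.z∈e w) x∈b y∈b) (walk-edge₆ w)

    -- An edge from `x` to `b` supplies a second point of `c` on `b`. Both points lie on `d`, where
    -- `collinear⇒edge` recovers the edge.
    edges-⊆ : ∀ {c d} → (∀ {x} → OnHexagon c x → OnHexagon d x) → ∀ u w → Edge c u w → Edge d u w
    edges-⊆ {c} {d} c⊆d (inj₁ x) (inj₂ b) e
      with on-x , x∈b , y , on-y , x≢y , y∈b ← edge⇒collinear {c} e
      = collinear⇒edge {d} (c⊆d on-x) (c⊆d on-y) x≢y x∈b y∈b
    edges-⊆ {c} {d} c⊆d (inj₂ b) (inj₁ x) e =
      edge-sym {d} (edges-⊆ {c} {d} c⊆d (inj₁ x) (inj₂ b) (edge-sym {c} e))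
    edges-⊆ {c} c⊆d (inj₁ _) (inj₁ _) e = ⊥-elim (edge⇒~ {c} e)
    edges-⊆ {c} c⊆d (inj₂ _) (inj₂ _) e = ⊥-elim (edge⇒~ {c} e)

    samePoints⇒≈ : ∀ {c d} → (∀ x → OnHexagon c x ⇔ OnHexagon d x) → c ≈ d
    samePoints⇒≈ {c} {d} same u w = mk⇔ (edges-⊆ {c} {d} (to (same _)) u w) (edges-⊆ {d} {c} (from (same _)) u w)

    -- A block through all three points would equal `b` by sharing p and q, and `d` by sharing q and
    -- z, although `b` and `d` differ.
    walk⇒triangle : ∀ {c i p} (w : Walk c i p) → Triangle I p (Walk.q w) (Walk.z w)
    walk⇒triangle w =
      (p≢q , _ , p∈b , q∈b) , (q≢z , _ , q∈d , z∈d) , (z≢p , _ , z∈e , p∈e) ,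
      λ (f , p∈f , q∈f , z∈f) → b≢d (trans (atMostOneBlock p≢q p∈b q∈b p∈f q∈f) (atMostOneBlock q≢z q∈f z∈f q∈d z∈d))
      where open Walk w

    sortedAt : ∀ k → SortedTriangle I (lookup (sortedTriangles I) k)
    sortedAt k = ∈-sortedTriangles⁻ (∈-lookup k)

    hexagonAt : Fin (length (sortedTriangles I)) → Hexagon
    hexagonAt k = triangleHexagon (proj₂ (proj₂ (sortedAt k)))

    hexagonAt-points : ∀ k x → OnHexagon (hexagonAt k) x ⇔ x ∈ˡ vertices (lookup (sortedTriangles I) k)
    hexagonAt-points k = triangleHexagon-points (proj₂ (proj₂ (sortedAt k)))

    -- Equal edges give equal point sets, these give equal sorted triples, and the list of triples
    -- has no repetition.
    hexagonAt-injective : ∀ {k l} → hexagonAt k ≈ hexagonAt l → k ≡ l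
    hexagonAt-injective {k} {l} k≈l =
      lookup-injective sortedTriangles-unique
        (sortedTriangle-unique (sortedAt k) (sortedAt l) λ x → mk⇔
          (to (hexagonAt-points l x) ∘ ≈⇒points-⊆ {hexagonAt k} {hexagonAt l} k≈l ∘ from (hexagonAt-points k x))
          (to (hexagonAt-points k x) ∘ ≈⇒points-⊆ {hexagonAt l} {hexagonAt k} (λ u w → mk⇔ (from (k≈l u w)) (to (k≈l u w)))
             ∘ from (hexagonAt-points l x)))

    -- The three points of a walk along `c`, once sorted, occur in the list; the hexagon built there
    -- has the same points as `c`, hence the same edges.
    hexagonAt-surjective : ∀ c → ∃[ k ] hexagonAt k ≈ c
    hexagonAt-surjective c
      with p , i , vi ← somePoint c
      with w ← walk c i vi
      with t , sorted , perm ← sortTriangle _ _ _ (walk⇒triangle w)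
      = k , samePoints⇒≈ {hexagonAt k} {c} λ x → mk⇔
          (on-walk w ∘ ∈-resp-↭ perm ∘ subst (λ t → x ∈ˡ vertices t) (sym t≡) ∘ to (hexagonAt-points k x))
          (λ (j , vj) → from (hexagonAt-points k x) (subst (λ t → x ∈ˡ vertices t) t≡ (∈-resp-↭ (↭-sym perm) (walk-points w vj))))
      where
      t∈ : t ∈ˡ sortedTriangles I
      t∈ = ∈-sortedTriangles⁺ sorted
      k : Fin (length (sortedTriangles I))
      k = Any.index t∈
      t≡ : t ≡ lookup (sortedTriangles I) k
      t≡ = lookup-index t∈

    hexagon-bijection : Bijection (setoid (Fin (length (sortedTriangles I))))
                                  (CycleSetoid (tannerGraph (incidenceMatrix I)) 6)
    hexagon-bijection = record
      { to = hexagonAt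
      ; cong = λ { refl u w → mk⇔ id id }
      ; bijective = hexagonAt-injective , λ c → let k , k≈c = hexagonAt-surjective c in k , λ { refl → k≈c }
      }

-- From the natural-number identity to the rational formula

count-formula : ∀ n s lam N → n ℕ.* ℕ.suc s ℕ.* s ℕ.* ℕ.suc lam ≡ 6 ℕ.* N ℕ.+ n ℕ.* ℕ.suc s ℕ.* s ℕ.* s →
                (+ N) / 1 ≡ (+ n * + s * (+ s + + 1) * (+ lam - + s + + 1)) / 6
-- `mkℚᵘ` stores the denominator minus one, so 0 and 5 encode 1 and 6. The goal becomes a
-- cross-multiplied identity of integers, where λ - s is a true difference.
count-formula n s lam N eq = fromℚᵘ-cong {mkℚᵘ (+ N) 0} {mkℚᵘ (+ n * + s * (+ s + + 1) * (+ lam - + s + + 1)) 5} (*≡* (begin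
  + N * + 6                                           ≡⟨ cancel (+ N) (A * + s) ⟩
  (+ 6 * + N + A * + s) - A * + s                     ≡⟨ cong (_- A * + s) eqℤ ⟨
  -- `factor` applies because `+ 1 + + k` computes to `+ ℕ.suc k`.
  A * + ℕ.suc lam - A * + s                           ≡⟨ factor (+ n) (+ s) (+ lam) ⟩
  + n * + s * (+ s + + 1) * (+ lam - + s + + 1) * + 1 ∎))
  where
  open ≡-Reasoning
  A : ℤ
  A = + n * + ℕ.suc s * + s
  pos-A* : ∀ k → + (n ℕ.* ℕ.suc s ℕ.* s ℕ.* k) ≡ A * + k
  pos-A* k = trans (ℤ.pos-* (n ℕ.* ℕ.suc s ℕ.* s) k)
               (cong (_* + k) (trans (ℤ.pos-* (n ℕ.* ℕ.suc s) s) (cong (_* + s) (ℤ.pos-* n (ℕ.suc s)))))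
  eqℤ : A * + ℕ.suc lam ≡ + 6 * + N + A * + s
  eqℤ = begin
    A * + ℕ.suc lam                                    ≡⟨ pos-A* (ℕ.suc lam) ⟨
    + (n ℕ.* ℕ.suc s ℕ.* s ℕ.* ℕ.suc lam)              ≡⟨ cong +_ eq ⟩
    + (6 ℕ.* N ℕ.+ n ℕ.* ℕ.suc s ℕ.* s ℕ.* s)          ≡⟨ cong₂ _+_ (ℤ.pos-* 6 N) (pos-A* s) ⟩
    + 6 * + N + A * + s                                ∎
  cancel : ∀ x y → x * + 6 ≡ (+ 6 * x + y) - y
  cancel = solveℤ-∀
  factor : ∀ n s l → n * (+ 1 + s) * s * (+ 1 + l) - n * (+ 1 + s) * s * s ≡ n * s * (s + + 1) * (l - s + + 1) * + 1
  factor = solveℤ-∀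

theorem4p5 : ∀ {v n r : ℕ} (I : IncidenceStructure v n) (s t : ℕ) (α : Fin r → ℕ) (lam μ : ℕ) →
    IsSRPG I s t α lam μ →
    (∃[ i ] α i ≥ 2) →
    ∃[ N ] (Bijection (setoid (Fin N)) (CycleSetoid (tannerGraph (incidenceMatrix I)) 6)
      × (+ N) / 1 ≡ (+ n * + s * (+ s + + 1) * (+ lam - + s + + 1)) / 6)
theorem4p5 {n = n} I s t α lam μ srpg _ =
  length (sortedTriangles I) ,
  hexagon-bijection I (IsPG.atMostOneBlock (IsSRPG.isPG srpg)) ,
  count-formula n s lam (length (sortedTriangles I)) (sortedTriangles-count I srpg)
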